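{- For each integer $n\ge 1$, the Tutte polynomial $T_n(x,y)=T(G_n;x,y)$ of the Farey graph $G_n$ is given by $$T_n(x,y)=T_{1,n}(x,y)+(x-1)N_n(x,y),$$ where the polynomials $T_{1,n}=T_{1,n}(x,y)$ and $N_n=N_n(x,y)$ satisfy the recursive relations $$T_{1,n}= y\,T_{1,n-1}^2 +2\,T_{1,n-1}N_{n-1}+(x-1)N_{n-1}^2,$$ $$N_{n}=2\,T_{1,n-1}N_{n-1}+(x-1)N_{n-1}^2,$$ with initial conditions $T_{1,0}(x,y)=1$ and $N_0(x,y)=1$.
   Context: Farey graphs. The Farey graphs $G_n$ ($n\ge 0$), each with two distinguished ("special") vertices $X_n,Y_n$, are defined recursively. $G_0$ is a single edge joining its two special vertices $X_0$ and $Y_0$. For $n\ge 1$, take two disjoint copies $G_{n-1}^1,G_{n-1}^2$ of $G_{n-1}$, with special vertices $X_{n-1}^i,Y_{n-1}^i$ ($i=1,2$); identify $Y_{n-1}^1$ with $X_{n-1}^2$ into one vertex, and add a new edge $e_n$ joining $X_{n-1}^1$ and $Y_{n-1}^2$. The result is $G_n$, with special vertices $X_n=X_{n-1}^1$ and $Y_n=Y_{n-1}^2$. It has $2^n+1$ vertices and $2^{n+1}-1$ edges. Tutte polynomial. A spanning subgraph $H$ of a graph $G$ is a subgraph with $V(H)=V(G)$ and $E(H)\subseteq E(G)$. With $k(H)$ the number of connected components of $H$, the rank is $r(H)=|V(H)|-k(H)$ and the nullity is $n(H)=|E(H)|-r(H)$. The Tutte polynomial is $$T(G;x,y)=\sum_{H}(x-1)^{r(G)-r(H)}(y-1)^{n(H)},$$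 the sum being over all spanning subgraphs $H$ of $G$. Partial sums. Let $G_{1,n}$ be the set of spanning subgraphs of $G_n$ in which $X_n$ and $Y_n$ belong to the same connected component, and $G_{2,n}$ the set of spanning subgraphs of $G_n$ in which $X_n$ and $Y_n$ belong to two different connected components. For $i=1,2$ and $n\ge0$ define $$T_{i,n}(x,y)=\sum_{H\in G_{i,n}}(x-1)^{r(G_n)-r(H)}(y-1)^{n(H)}.$$ For every $n\ge 0$ the polynomial $T_{2,n}$ is divisible by $x-1$, and $N_n(x,y)\in\mathbb{Z}[x,y]$ denotes the quotient, i.e. $T_{2,n}(x,y)=(x-1)N_n(x,y)$. -}

module Defs where

open import Algebra.Bundles using (CommutativeRing)
import Algebra.Properties.AbelianGroup as AbelianGroupProperties
import Algebra.Properties.CommutativeSemigroup as CommutativeSemigroupProperties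
import Algebra.Properties.Semiring.Exp as SemiringExp
import Algebra.Properties.Semiring.Mult as SemiringMult
open import Data.Fin.Base using (Fin; zero; suc; _↑ˡ_; _↑ʳ_; splitAt)
import Data.Fin.Properties as Fin
open import Data.Fin.Subset using (Subset; inside; outside; _∈_; ∣_∣; ⊤)
open import Data.Fin.Subset.Properties using (∈⊤)
import Data.Integer.Properties as ℤ
open import Data.List.Base as List using (List; []; _∷_)
open import Data.List.Membership.Propositional.Properties using (∈-allFin)
import Data.List.Properties as List
open import Data.List.Relation.Unary.All as All using (All; []; _∷_)
open import Data.List.Relation.Unary.All.Properties using (all-filter)
open import Data.List.Relation.Unary.Any as Any using (Any; here)
import Data.List.Relation.Unary.Any.Properties as Any
open import Data.Nat.Base as ℕ using (ℕ; zero; suc; _<_; _≤_; _∸_; z≤n; s≤s)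
import Data.Nat.Properties as ℕ
open import Data.Product.Base using (∃; _×_; _,_; proj₁; proj₂)
open import Data.Sum.Base using (inj₁; inj₂)
open import Data.Vec.Base as Vec using (Vec; []; _∷_; lookup)
import Data.Vec.Properties as Vec
open import Function.Base using (_∘_)
open import Relation.Binary.Bundles using (Setoid)
open import Relation.Binary.Construct.Closure.Equivalence as Eq using (EqClosure)
open import Relation.Binary.Core using (Rel)
open import Relation.Binary.Definitions using (Decidable)
open import Relation.Binary.PropositionalEquality as ≡ using (_≡_; cong)
open import Relation.Nullary using (Dec; yes; no; ¬_; ¬?; contradiction)
open import Relation.Nullary.Decidable as Dec using ()

module Polynomial {c ℓ} (R : CommutativeRing c ℓ) where

  open CommutativeRing R renaming (Carrier to A)
  open CommutativeSemigroupProperties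
    (CommutativeRing.+-commutativeSemigroup R) using (interchange; x∙yz≈y∙xz)
  open AbelianGroupProperties +-abelianGroup using (ε⁻¹≈ε)
  open import Relation.Binary.Reasoning.Setoid setoid

  -- [a₀, a₁, …] represents a₀ + a₁ X + …; trailing zeros are allowed, so
  -- equality is equality of all coefficients.
  Poly : Set c
  Poly = List A

  coeff : Poly → ℕ → A
  coeff []      _       = 0#
  coeff (a ∷ _) zero    = a
  coeff (_ ∷ p) (suc i) = coeff p i

  infix 4 _≋_
  record _≋_ (p q : Poly) : Set ℓ where
    constructor coeffwise
    field at : ∀ i → coeff p i ≈ coeff q i
  open _≋_

  C : A → Poly
  C a = a ∷ []

  X : Poly
  X = 0# ∷ 1# ∷ []

  infixl 6 _⊕_
  infixl 7 _⊛_ _⊙_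

  _⊕_ : Poly → Poly → Poly
  []      ⊕ q       = q
  (a ∷ p) ⊕ []      = a ∷ p
  (a ∷ p) ⊕ (b ∷ q) = a + b ∷ p ⊕ q

  ⊖_ : Poly → Poly
  ⊖_ = List.map (-_)

  _⊙_ : A → Poly → Poly
  a ⊙ p = List.map (a *_) p

  _⊛_ : Poly → Poly → Poly
  []      ⊛ _ = []
  (a ∷ p) ⊛ q = a ⊙ q ⊕ (0# ∷ p ⊛ q)

  ⊕-coeff : ∀ p q i → coeff (p ⊕ q) i ≈ coeff p i + coeff q i
  ⊕-coeff []      q       i       = sym (+-identityˡ _)
  ⊕-coeff (a ∷ p) []      i       = sym (+-identityʳ _)
  ⊕-coeff (a ∷ p) (b ∷ q) zero    = refl
  ⊕-coeff (a ∷ p) (b ∷ q) (suc i) = ⊕-coeff p q i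

  ⊖-coeff : ∀ p i → coeff (⊖ p) i ≈ - coeff p i
  ⊖-coeff []      i       = sym ε⁻¹≈ε
  ⊖-coeff (a ∷ p) zero    = refl
  ⊖-coeff (a ∷ p) (suc i) = ⊖-coeff p i

  ⊙-coeff : ∀ a p i → coeff (a ⊙ p) i ≈ a * coeff p i
  ⊙-coeff a []      i       = sym (zeroʳ a)
  ⊙-coeff a (b ∷ p) zero    = refl
  ⊙-coeff a (b ∷ p) (suc i) = ⊙-coeff a p i

  conv : (ℕ → A) → (ℕ → A) → ℕ → A
  conv f g zero    = f 0 * g 0
  conv f g (suc n) = f 0 * g (suc n) + conv (f ∘ suc) g n

  conv-cong : ∀ {f f′ g g′} → (∀ i → f i ≈ f′ i) → (∀ i → g i ≈ g′ i) →
              ∀ n → conv f g n ≈ conv f′ g′ n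
  conv-cong p q zero    = *-cong (p 0) (q 0)
  conv-cong p q (suc n) =
    +-cong (*-cong (p 0) (q (suc n))) (conv-cong (p ∘ suc) q n)

  conv-zeroˡ : ∀ g n → conv (λ _ → 0#) g n ≈ 0#
  conv-zeroˡ g zero    = zeroˡ _
  conv-zeroˡ g (suc n) = begin
    0# * g (suc n) + conv (λ _ → 0#) g n ≈⟨ +-cong (zeroˡ _) (conv-zeroˡ g n) ⟩
    0# + 0#                              ≈⟨ +-identityʳ _ ⟩
    0#                                   ∎

  conv-sucʳ : ∀ f g n →
              conv f g (suc n) ≈ f (suc n) * g 0 + conv f (g ∘ suc) n
  conv-sucʳ f g zero    = +-comm _ _
  conv-sucʳ f g (suc n) = begin
    f 0 * g (2 ℕ.+ n) + conv (f ∘ suc) g (suc n)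
      ≈⟨ +-congˡ (conv-sucʳ (f ∘ suc) g n) ⟩
    f 0 * g (2 ℕ.+ n) + (f (2 ℕ.+ n) * g 0 + conv (f ∘ suc) (g ∘ suc) n)
      ≈⟨ x∙yz≈y∙xz _ _ _ ⟩
    f (2 ℕ.+ n) * g 0 + (f 0 * g (2 ℕ.+ n) + conv (f ∘ suc) (g ∘ suc) n) ∎

  conv-comm : ∀ f g n → conv f g n ≈ conv g f n
  conv-comm f g zero    = *-comm _ _
  conv-comm f g (suc n) = begin
    f 0 * g (suc n) + conv (f ∘ suc) g n
      ≈⟨ +-cong (*-comm _ _) (conv-comm (f ∘ suc) g n) ⟩
    g (suc n) * f 0 + conv g (f ∘ suc) n
      ≈⟨ conv-sucʳ g f n ⟨
    conv g f (suc n) ∎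

  conv-distribʳ : ∀ f g h n →
    conv (λ i → g i + h i) f n ≈ conv g f n + conv h f n
  conv-distribʳ f g h zero    = distribʳ _ _ _
  conv-distribʳ f g h (suc n) = begin
    (g 0 + h 0) * f (suc n) + conv (λ i → g (suc i) + h (suc i)) f n
      ≈⟨ +-cong (distribʳ _ _ _) (conv-distribʳ f (g ∘ suc) (h ∘ suc) n) ⟩
    (g 0 * f (suc n) + h 0 * f (suc n)) + (conv (g ∘ suc) f n + conv (h ∘ suc) f n)
      ≈⟨ interchange _ _ _ _ ⟩
    conv g f (suc n) + conv h f (suc n) ∎

  conv-scale : ∀ a f g n → conv (λ i → a * f i) g n ≈ a * conv f g n
  conv-scale a f g zero    = *-assoc _ _ _
  conv-scale a f g (suc n) = begin
    a * f 0 * g (suc n) + conv (λ i → a * f (suc i)) g n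
      ≈⟨ +-cong (*-assoc _ _ _) (conv-scale a (f ∘ suc) g n) ⟩
    a * (f 0 * g (suc n)) + a * conv (f ∘ suc) g n
      ≈⟨ distribˡ _ _ _ ⟨
    a * conv f g (suc n) ∎

  conv-assoc : ∀ f g h n → conv (conv f g) h n ≈ conv f (conv g h) n
  conv-assoc f g h zero    = *-assoc _ _ _
  conv-assoc f g h (suc n) = begin
    f 0 * g 0 * h (suc n) + conv (λ i → f 0 * g (suc i) + conv (f ∘ suc) g i) h n
      ≈⟨ +-cong (*-assoc _ _ _) (conv-distribʳ h _ _ n) ⟩
    f 0 * (g 0 * h (suc n)) + (conv (λ i → f 0 * g (suc i)) h n + conv (conv (f ∘ suc) g) h n)
      ≈⟨ +-congˡ (+-cong (conv-scale (f 0) (g ∘ suc) h n) (conv-assoc (f ∘ suc) g h n)) ⟩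
    f 0 * (g 0 * h (suc n)) + (f 0 * conv (g ∘ suc) h n + conv (f ∘ suc) (conv g h) n)
      ≈⟨ +-assoc _ _ _ ⟨
    f 0 * (g 0 * h (suc n)) + f 0 * conv (g ∘ suc) h n + conv (f ∘ suc) (conv g h) n
      ≈⟨ +-congʳ (distribˡ _ _ _) ⟨
    f 0 * conv g h (suc n) + conv (f ∘ suc) (conv g h) n ∎

  ⊛-coeff : ∀ p q n → coeff (p ⊛ q) n ≈ conv (coeff p) (coeff q) n
  ⊛-coeff []      q n       = sym (conv-zeroˡ (coeff q) n)
  ⊛-coeff (a ∷ p) q zero    = begin
    coeff (a ⊙ q ⊕ (0# ∷ p ⊛ q)) 0 ≈⟨ ⊕-coeff (a ⊙ q) (0# ∷ p ⊛ q) 0 ⟩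
    coeff (a ⊙ q) 0 + 0#           ≈⟨ +-identityʳ _ ⟩
    coeff (a ⊙ q) 0                ≈⟨ ⊙-coeff a q 0 ⟩
    a * coeff q 0                  ∎
  ⊛-coeff (a ∷ p) q (suc n) = begin
    coeff (a ⊙ q ⊕ (0# ∷ p ⊛ q)) (suc n)
      ≈⟨ ⊕-coeff (a ⊙ q) (0# ∷ p ⊛ q) (suc n) ⟩
    coeff (a ⊙ q) (suc n) + coeff (p ⊛ q) n
      ≈⟨ +-cong (⊙-coeff a q (suc n)) (⊛-coeff p q n) ⟩
    a * coeff q (suc n) + conv (coeff p) (coeff q) n ∎

  ⊛-cong : ∀ {p p′ q q′} → p ≋ p′ → q ≋ q′ → p ⊛ q ≋ p′ ⊛ q′
  ⊛-cong {p} {p′} {q} {q′} e f .at n = begin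
    coeff (p ⊛ q) n              ≈⟨ ⊛-coeff p q n ⟩
    conv (coeff p) (coeff q) n   ≈⟨ conv-cong (at e) (at f) n ⟩
    conv (coeff p′) (coeff q′) n ≈⟨ ⊛-coeff p′ q′ n ⟨
    coeff (p′ ⊛ q′) n            ∎

  ⊛-comm : ∀ p q → p ⊛ q ≋ q ⊛ p
  ⊛-comm p q .at n = begin
    coeff (p ⊛ q) n            ≈⟨ ⊛-coeff p q n ⟩
    conv (coeff p) (coeff q) n ≈⟨ conv-comm (coeff p) (coeff q) n ⟩
    conv (coeff q) (coeff p) n ≈⟨ ⊛-coeff q p n ⟨
    coeff (q ⊛ p) n            ∎

  ⊛-assoc : ∀ p q r → (p ⊛ q) ⊛ r ≋ p ⊛ (q ⊛ r)
  ⊛-assoc p q r .at n = begin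
    coeff ((p ⊛ q) ⊛ r) n
      ≈⟨ ⊛-coeff (p ⊛ q) r n ⟩
    conv (coeff (p ⊛ q)) (coeff r) n
      ≈⟨ conv-cong (⊛-coeff p q) (λ _ → refl) n ⟩
    conv (conv (coeff p) (coeff q)) (coeff r) n
      ≈⟨ conv-assoc (coeff p) (coeff q) (coeff r) n ⟩
    conv (coeff p) (conv (coeff q) (coeff r)) n
      ≈⟨ conv-cong (λ _ → refl) (⊛-coeff q r) n ⟨
    conv (coeff p) (coeff (q ⊛ r)) n
      ≈⟨ ⊛-coeff p (q ⊛ r) n ⟨
    coeff (p ⊛ (q ⊛ r)) n ∎

  ⊛-identityˡ : ∀ p → C 1# ⊛ p ≋ p
  ⊛-identityˡ p .at zero    = begin
    coeff (C 1# ⊛ p) 0 ≈⟨ ⊛-coeff (C 1#) p 0 ⟩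
    1# * coeff p 0     ≈⟨ *-identityˡ _ ⟩
    coeff p 0          ∎
  ⊛-identityˡ p .at (suc n) = begin
    coeff (C 1# ⊛ p) (suc n)
      ≈⟨ ⊛-coeff (C 1#) p (suc n) ⟩
    1# * coeff p (suc n) + conv (λ _ → 0#) (coeff p) n
      ≈⟨ +-cong (*-identityˡ _) (conv-zeroˡ (coeff p) n) ⟩
    coeff p (suc n) + 0#
      ≈⟨ +-identityʳ _ ⟩
    coeff p (suc n) ∎

  ⊛-distribʳ : ∀ p q r → (q ⊕ r) ⊛ p ≋ q ⊛ p ⊕ r ⊛ p
  ⊛-distribʳ p q r .at n = begin
    coeff ((q ⊕ r) ⊛ p) n
      ≈⟨ ⊛-coeff (q ⊕ r) p n ⟩
    conv (coeff (q ⊕ r)) (coeff p) n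
      ≈⟨ conv-cong (⊕-coeff q r) (λ _ → refl) n ⟩
    conv (λ i → coeff q i + coeff r i) (coeff p) n
      ≈⟨ conv-distribʳ (coeff p) (coeff q) (coeff r) n ⟩
    conv (coeff q) (coeff p) n + conv (coeff r) (coeff p) n
      ≈⟨ +-cong (⊛-coeff q p n) (⊛-coeff r p n) ⟨
    coeff (q ⊛ p) n + coeff (r ⊛ p) n
      ≈⟨ ⊕-coeff (q ⊛ p) (r ⊛ p) n ⟨
    coeff (q ⊛ p ⊕ r ⊛ p) n ∎

  ⊕-cong : ∀ {p p′ q q′} → p ≋ p′ → q ≋ q′ → p ⊕ q ≋ p′ ⊕ q′
  ⊕-cong {p} {p′} {q} {q′} e f .at n = begin
    coeff (p ⊕ q) n         ≈⟨ ⊕-coeff p q n ⟩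
    coeff p n + coeff q n   ≈⟨ +-cong (at e n) (at f n) ⟩
    coeff p′ n + coeff q′ n ≈⟨ ⊕-coeff p′ q′ n ⟨
    coeff (p′ ⊕ q′) n       ∎

  ⊕-comm : ∀ p q → p ⊕ q ≋ q ⊕ p
  ⊕-comm p q .at n = begin
    coeff (p ⊕ q) n       ≈⟨ ⊕-coeff p q n ⟩
    coeff p n + coeff q n ≈⟨ +-comm _ _ ⟩
    coeff q n + coeff p n ≈⟨ ⊕-coeff q p n ⟨
    coeff (q ⊕ p) n       ∎

  ⊕-assoc : ∀ p q r → (p ⊕ q) ⊕ r ≋ p ⊕ (q ⊕ r)
  ⊕-assoc p q r .at n = begin
    coeff ((p ⊕ q) ⊕ r) n               ≈⟨ ⊕-coeff (p ⊕ q) r n ⟩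
    coeff (p ⊕ q) n + coeff r n         ≈⟨ +-congʳ (⊕-coeff p q n) ⟩
    coeff p n + coeff q n + coeff r n   ≈⟨ +-assoc _ _ _ ⟩
    coeff p n + (coeff q n + coeff r n) ≈⟨ +-congˡ (⊕-coeff q r n) ⟨
    coeff p n + coeff (q ⊕ r) n         ≈⟨ ⊕-coeff p (q ⊕ r) n ⟨
    coeff (p ⊕ (q ⊕ r)) n               ∎

  ⊖-cong : ∀ {p q} → p ≋ q → ⊖ p ≋ ⊖ q
  ⊖-cong {p} {q} e .at n = begin
    coeff (⊖ p) n ≈⟨ ⊖-coeff p n ⟩
    - coeff p n   ≈⟨ -‿cong (at e n) ⟩
    - coeff q n   ≈⟨ ⊖-coeff q n ⟨
    coeff (⊖ q) n ∎

  ⊖-inverseˡ : ∀ p → ⊖ p ⊕ p ≋ []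
  ⊖-inverseˡ p .at n = begin
    coeff (⊖ p ⊕ p) n         ≈⟨ ⊕-coeff (⊖ p) p n ⟩
    coeff (⊖ p) n + coeff p n ≈⟨ +-congʳ (⊖-coeff p n) ⟩
    - coeff p n + coeff p n   ≈⟨ -‿inverseˡ _ ⟩
    0#                        ∎

  ≋-refl : ∀ {p} → p ≋ p
  ≋-refl .at _ = refl

  ≋-sym : ∀ {p q} → p ≋ q → q ≋ p
  ≋-sym e .at i = sym (at e i)

  ≋-trans : ∀ {p q r} → p ≋ q → q ≋ r → p ≋ r
  ≋-trans e f .at i = trans (at e i) (at f i)

  commutativeRing : CommutativeRing c ℓ
  commutativeRing = record
    { Carrier = Poly
    ; _≈_ = _≋_
    ; _+_ = _⊕_
    ; _*_ = _⊛_
    ; -_  = ⊖_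
    ; 0#  = []
    ; 1#  = C 1#
    ; isCommutativeRing = record
      { isRing = record
        { +-isAbelianGroup = record
          { isGroup = record
            { isMonoid = record
              { isSemigroup = record
                { isMagma = record
                  { isEquivalence = record
                    { refl = ≋-refl ; sym = ≋-sym ; trans = ≋-trans }
                  ; ∙-cong = ⊕-cong
                  }
                ; assoc = ⊕-assoc
                }
              ; identity = (λ _ → ≋-refl) , (λ p → ⊕-comm p [])
              }
            ; inverse = ⊖-inverseˡ , λ p → ≋-trans (⊕-comm p (⊖ p)) (⊖-inverseˡ p)
            ; ⁻¹-cong = ⊖-cong
            }
          ; comm = ⊕-comm
          }
        ; *-cong = ⊛-cong
        ; *-assoc = ⊛-assoc
        ; *-identity = ⊛-identityˡ , λ p → ≋-trans (⊛-comm p (C 1#)) (⊛-identityˡ p)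
        ; distrib =
            (λ p q r → ≋-trans (⊛-comm p (q ⊕ r))
              (≋-trans (⊛-distribʳ p q r) (⊕-cong (⊛-comm q p) (⊛-comm r p))))
          , ⊛-distribʳ
        }
      ; *-comm = ⊛-comm
      }
    }

ℤ[x] : CommutativeRing _ _
ℤ[x] = Polynomial.commutativeRing ℤ.+-*-commutativeRing

ℤ[x,y] : CommutativeRing _ _
ℤ[x,y] = Polynomial.commutativeRing ℤ[x]

open CommutativeRing ℤ[x,y] public
  using (_≈_; _+_; _*_; _-_; 0#; 1#) renaming (Carrier to Poly[x,y])
open SemiringExp (CommutativeRing.semiring ℤ[x,y]) public using (_^_)
open SemiringMult (CommutativeRing.semiring ℤ[x,y]) public
  using () renaming (_×_ to _·_)

x y : Poly[x,y]
x = Polynomial.C ℤ[x] (Polynomial.X ℤ.+-*-commutativeRing)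
y = Polynomial.X ℤ[x]

∑ : ∀ {a} {A : Set a} → List A → (A → Poly[x,y]) → Poly[x,y]
∑ []       f = 0#
∑ (a ∷ as) f = f a + ∑ as f

-- Finite multigraphs: loops and parallel edges are allowed, and an edge is
-- stored as an ordered pair whose order is ignored by `Connected`.
record Graph : Set where
  field
    order : ℕ
    size  : ℕ
    ends  : Vec (Fin order × Fin order) size

-- Connectivity of the spanning subgraph with edge set H.
module Connectivity {v : ℕ} where

  Adjacent : ∀ {m} → Vec (Fin v × Fin v) m → Subset m → Rel (Fin v) _
  Adjacent es H a b = ∃ λ e → e ∈ H × lookup es e ≡ (a , b)

  Connected : ∀ {m} → Vec (Fin v × Fin v) m → Subset m → Rel (Fin v) _
  Connected es H = EqClosure (Adjacent es H)

  weaken : ∀ {m e s H} {es : Vec (Fin v × Fin v) m} {a b} →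
           Connected es H a b → Connected (e ∷ es) (s ∷ H) a b
  weaken = Eq.map λ (i , i∈H , eq) → suc i , Vec.there i∈H , eq

  -- Contracting the first edge: its second end is sent to its first one.
  module _ {m} (es : Vec (Fin v × Fin v) m) (H : Subset m) (a b : Fin v)
           (connected? : Decidable (Connected es H)) where

    private
      module E = Setoid (Eq.setoid (Adjacent es H))
      module E⁺ = Setoid (Eq.setoid (Adjacent ((a , b) ∷ es) (inside ∷ H)))

    contract : Fin v → Fin v
    contract w with connected? w b
    ... | yes _ = a
    ... | no  _ = w

    contract-connected : ∀ w → w E⁺.≈ contract w
    contract-connected w with connected? w b
    ... | yes w~b = E⁺.trans (weaken w~b)
                      (E⁺.sym (Eq.return (zero , Vec.here , ≡.refl)))
    ... | no  _   = E⁺.refl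

    contract-cong : ∀ {u w} → u E.≈ w → contract u E.≈ contract w
    contract-cong {u} {w} u~w with connected? u b | connected? w b
    ... | yes _   | yes _   = E.refl
    ... | yes u~b | no  w≁b = contradiction (E.trans (E.sym u~w) u~b) w≁b
    ... | no  u≁b | yes w~b = contradiction (E.trans u~w w~b) u≁b
    ... | no  _   | no  _   = u~w

    contract-ends : contract a E.≈ contract b
    contract-ends with connected? a b | connected? b b
    ... | yes _ | yes _   = E.refl
    ... | no  _ | yes _   = E.refl
    ... | _     | no  b≁b = contradiction E.refl b≁b

    contract⁻ : ∀ {u w} → contract u E.≈ contract w → u E⁺.≈ w
    contract⁻ {u} {w} c = E⁺.trans (contract-connected u)
      (E⁺.trans (weaken c) (E⁺.sym (contract-connected w)))

    contract⁺ : ∀ {u w} → u E⁺.≈ w → contract u E.≈ contract w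
    contract⁺ = Eq.gfold E.isEquivalence contract λ where
      (zero  , _              , ≡.refl) → contract-ends
      (suc e , Vec.there e∈H , eq)      → contract-cong (Eq.return (e , e∈H , eq))

  connected? : ∀ {m} (es : Vec (Fin v × Fin v) m) H → Decidable (Connected es H)
  connected? []             []            a b =
    Dec.map′ (λ { ≡.refl → Eq.reflexive _ })
             (Eq.fold ≡.isEquivalence λ ()) (a Fin.≟ b)
  connected? (e ∷ es)       (outside ∷ H) a b =
    Dec.map′ weaken
             (Eq.map λ { (suc i , Vec.there i∈H , eq) → i , i∈H , eq })
             (connected? es H a b)
  connected? ((c , d) ∷ es) (inside ∷ H)  a b =
    Dec.map′ (contract⁻ es H c d (connected? es H))
             (contract⁺ es H c d (connected? es H))
             (connected? es H _ _)

subsets : ∀ m → List (Subset m)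
subsets zero    = [] ∷ []
subsets (suc m) = List.cartesianProductWith _∷_ (outside ∷ inside ∷ []) (subsets m)

module _ (G : Graph) where

  open Graph G

  SpanningSubgraph : Set
  SpanningSubgraph = Subset size

  spanningSubgraphs : List SpanningSubgraph
  spanningSubgraphs = subsets size

  Connected : SpanningSubgraph → Rel (Fin order) _
  Connected = Connectivity.Connected ends

  connected? : ∀ H → Decidable (Connected H)
  connected? = Connectivity.connected? ends

  -- Number of connected components: keep one vertex of each class.
  k : SpanningSubgraph → ℕ
  k H = List.length (List.deduplicate (connected? H) (List.allFin order))

  -- Each ∸ below is a true difference: 1 ≤ k H ≤ order for nonempty G,
  -- r H ≤ ∣ H ∣, and r H ≤ r ⊤.
  r : SpanningSubgraph → ℕ
  r H = order ∸ k H

  nullity : SpanningSubgraph → ℕ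
  nullity H = ∣ H ∣ ∸ r H

  -- G itself is the spanning subgraph ⊤.
  term : SpanningSubgraph → Poly[x,y]
  term H = (x - 1#) ^ (r ⊤ ∸ r H) * (y - 1#) ^ nullity H

  Tutte : Poly[x,y]
  Tutte = ∑ spanningSubgraphs term

  private
    representatives : SpanningSubgraph → List (Fin order)
    representatives H = List.deduplicate (connected? H) (List.allFin order)

    represented : ∀ H v → Any (Connected H v) (representatives H)
    represented H v = Any.deduplicate⁺ (connected? H)
      (λ b~a v~a → E.trans v~a (E.sym b~a)) (Any.map (λ { ≡.refl → E.refl }) (∈-allFin v))
      where module E = Setoid (Eq.setoid (Connectivity.Adjacent ends H))

  k≤order : ∀ H → k H ≤ order
  k≤order H = ℕ.≤-trans
    (List.length-deduplicate (connected? H) (List.allFin order))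
    (ℕ.≤-reflexive (List.length-tabulate (λ i → i)))

  separated⇒1<k : ∀ {H u v} → ¬ Connected H u v → 1 < k H
  separated⇒1<k {H} {u} {v} u≁v
    with representatives H | represented H u | represented H v
  ... | _ ∷ _ ∷ _ | _        | _        = s≤s (s≤s z≤n)
  ... | _ ∷ []    | here u~w | here v~w = contradiction (E.trans u~w (E.sym v~w)) u≁v
    where module E = Setoid (Eq.setoid (Connectivity.Adjacent ends H))

-- A graph with two special vertices, the first of which is vertex zero.
record TwoTerminalGraph : Set where
  field
    others : ℕ  -- number of vertices other than X
    size   : ℕ
    ends   : Vec (Fin (suc others) × Fin (suc others)) size
    Y      : Fin (suc others)

  X : Fin (suc others)
  X = zero

  graph : Graph
  graph = record { order = suc others ; size = size ; ends = ends }

-- Two copies of G with Y of the first identified with X of the second, and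
-- a new edge joining X of the first to Y of the second.  The vertices are
-- those of the first copy followed by those of the second other than X.
module Double (G : TwoTerminalGraph) where

  open TwoTerminalGraph G

  copy₁ copy₂ : Fin (suc others) → Fin (suc others ℕ.+ others)
  copy₁ v       = v ↑ˡ others
  copy₂ zero    = copy₁ Y
  copy₂ (suc v) = suc others ↑ʳ v

  both : ∀ {a b} {A : Set a} {B : Set b} → (A → B) → A × A → B × B
  both f (u , v) = f u , f v

  double : TwoTerminalGraph
  double = record
    { others = others ℕ.+ others
    ; size   = suc (size ℕ.+ size)
    ; ends   = (copy₁ X , copy₂ Y)
             ∷ Vec.map (both copy₁) ends Vec.++ Vec.map (both copy₂) ends
    ; Y      = copy₂ Y
    }

open Double using (double)

farey : ℕ → TwoTerminalGraph
farey zero    = record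
  { others = 1
  ; size   = 1
  ; ends   = (zero , suc zero) ∷ []
  ; Y      = suc zero
  }
farey (suc n) = double (farey n)

module _ (n : ℕ) where

  open TwoTerminalGraph (farey n)

  XYConnected? : ∀ H → Dec (Connected graph H X Y)
  XYConnected? H = connected? graph H X Y

  G₁ G₂ : List (SpanningSubgraph graph)
  G₁ = List.filter XYConnected? (spanningSubgraphs graph)
  G₂ = List.filter (λ H → ¬? (XYConnected? H)) (spanningSubgraphs graph)

  T T₁ T₂ : Poly[x,y]
  T  = Tutte graph
  T₁ = ∑ G₁ (term graph)
  T₂ = ∑ G₂ (term graph)

  connected⇒k≤1 : (∀ v → Connected graph ⊤ X v) → k graph ⊤ ≤ 1
  connected⇒k≤1 X~ = s≤s (ℕ.≤-reflexive (cong List.length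
    (List.filter-none (λ v → ¬? (connected? graph ⊤ X v))
      (All.universal (λ v X≁v → X≁v (X~ v))
        (List.deduplicate (connected? graph ⊤) (List.tabulate suc))))))

module _ (G : TwoTerminalGraph) where

  open TwoTerminalGraph G
  open Double G hiding (double)
  private
    module D = TwoTerminalGraph (double G)
    module E = Setoid (Eq.setoid (Connectivity.Adjacent D.ends ⊤))

    ends₁ ends₂ : Vec _ size
    ends₁ = Vec.map (both copy₁) ends
    ends₂ = Vec.map (both copy₂) ends

  copy₁-connected : ∀ {u v} → Connected graph ⊤ u v → Connected D.graph ⊤ (copy₁ u) (copy₁ v)
  copy₁-connected = Eq.gmap copy₁ λ (e , _ , eq) → suc (e ↑ˡ size) , ∈⊤ ,
    ≡.trans (Vec.lookup-++ˡ ends₁ ends₂ e)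
      (≡.trans (Vec.lookup-map e (both copy₁) ends) (cong (both copy₁) eq))

  copy₂-connected : ∀ {u v} → Connected graph ⊤ u v → Connected D.graph ⊤ (copy₂ u) (copy₂ v)
  copy₂-connected = Eq.gmap copy₂ λ (e , _ , eq) → suc (size ↑ʳ e) , ∈⊤ ,
    ≡.trans (Vec.lookup-++ʳ ends₁ ends₂ e)
      (≡.trans (Vec.lookup-map e (both copy₂) ends) (cong (both copy₂) eq))

  double-connected : (∀ v → Connected graph ⊤ X v) → ∀ v → Connected D.graph ⊤ D.X v
  double-connected X~ v with splitAt (suc others) v in eq
  ... | inj₁ u with ≡.refl ← Fin.splitAt⁻¹-↑ˡ {i = v} eq = copy₁-connected (X~ u)
  ... | inj₂ w with ≡.refl ← Fin.splitAt⁻¹-↑ʳ {i = v} eq =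
    E.trans (copy₁-connected (X~ Y)) (copy₂-connected (X~ (suc w)))

farey-connected : ∀ n v → let open TwoTerminalGraph (farey n) in Connected graph ⊤ X v
farey-connected zero    zero       = Eq.reflexive _
farey-connected zero    (suc zero) = Eq.return (zero , ∈⊤ , ≡.refl)
farey-connected (suc n) v          = double-connected (farey n) (farey-connected n) v

module _ (n : ℕ) where

  open TwoTerminalGraph (farey n)
  open CommutativeRing ℤ[x,y] using (setoid; *-assoc; +-cong; zeroʳ; distribˡ; sym)
  open import Relation.Binary.Reasoning.Setoid setoid

  private
    term-divisible : ∀ {H} → ¬ Connected graph H X Y → ∃ λ q → term graph H ≈ (x - 1#) * q
    term-divisible {H} X≁Y
      with r graph ⊤ ∸ r graph H
         | ℕ.m<n⇒0<n∸m (ℕ.∸-monoʳ-< (ℕ.≤-<-trans (connected⇒k≤1 n (farey-connected n))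
                                                 (separated⇒1<k graph X≁Y))
                                    (k≤order graph H))
    ... | suc d | _ = _ , *-assoc (x - 1#) ((x - 1#) ^ d) _

    ∑-divisible : ∀ {Hs} → All (λ H → ¬ Connected graph H X Y) Hs →
                  ∃ λ q → ∑ Hs (term graph) ≈ (x - 1#) * q
    ∑-divisible []                   = 0# , sym (zeroʳ (x - 1#))
    ∑-divisible {H ∷ Hs} (X≁Y ∷ X≁Ys) =
      let q , eq = term-divisible X≁Y ; q′ , eq′ = ∑-divisible X≁Ys in
      q + q′ , (begin
        term graph H + ∑ Hs (term graph)  ≈⟨ +-cong eq eq′ ⟩
        (x - 1#) * q + (x - 1#) * q′      ≈⟨ distribˡ (x - 1#) q q′ ⟨
        (x - 1#) * (q + q′)               ∎)

  T₂-divisible : ∃ λ q → T₂ n ≈ (x - 1#) * q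
  T₂-divisible = ∑-divisible (all-filter _ (spanningSubgraphs graph))

  -- The quotient is unique: x - 1 is not a zero divisor.
  N : Poly[x,y]
  N = proj₁ T₂-divisible

{-# OPTIONS --safe #-}
module Submission where

-- The rank of a spanning subgraph is the number of edges accepted by Kruskal's algorithm.  Each copy
-- is a retract of the two copies glued at a vertex, so gluing creates no connection inside a copy
-- and rank and nullity are additive.  The new edge raises the nullity by one if X and Y are joined
-- in both copies, and the rank by one otherwise.  Writing ′ for the next index, this gives
--   T₂′ = 2 T₁ T₂ + T₂²   and   (x - 1) T₁′ = (x - 1) y T₁² + 2 T₁ T₂ + T₂²;
-- substituting T₂ = (x - 1) N and cancelling x - 1 yields the recursions.

open import Defs
open import Algebra.Bundles using (CommutativeRing)
import Algebra.Properties.AbelianGroup as AbelianGroupProperties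
import Algebra.Properties.CommutativeSemigroup as CommutativeSemigroupProperties
import Algebra.Properties.Ring as RingProperties
import Algebra.Properties.Semiring.Exp as SemiringExp
import Algebra.Properties.Semiring.Mult as SemiringMult
import Algebra.Solver.Ring.NaturalCoefficients.Default as RingSolver
open import Data.Bool.Base using (Bool; true; false; if_then_else_; not; _∧_)
open import Data.Fin.Base using (Fin; zero; suc; splitAt)
import Data.Fin.Properties as Fin
open import Data.Fin.Subset using (Subset; inside; outside; ∣_∣; ⊤)
open import Data.Integer.Base using (-1ℤ; 1ℤ)
import Data.Integer.Properties as ℤ
open import Data.List.Base as List using (List; []; _∷_; length)
open import Data.List.Membership.Propositional.Properties using (∈-allFin)
import Data.List.Properties as List
open import Data.List.Relation.Unary.All as All using (All; []; _∷_)
import Data.List.Relation.Unary.All.Properties as All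
open import Data.List.Relation.Unary.AllPairs as AllPairs using ([]; _∷_)
open import Data.List.Relation.Unary.Any as Any using (here; there; _─_; index)
import Data.List.Relation.Unary.Any.Properties as Any
open import Data.List.Relation.Unary.Enumerates.Setoid using (IsEnumeration)
import Data.List.Relation.Unary.Enumerates.Setoid.Properties as Enumerates
open import Data.List.Relation.Unary.Unique.DecSetoid.Properties using (deduplicate-!)
open import Data.List.Relation.Unary.Unique.Propositional.Properties using (allFin⁺)
open import Data.List.Relation.Unary.Unique.Setoid using (Unique)
import Data.List.Relation.Unary.Unique.Setoid.Properties as Unique
open import Data.Nat.Base as ℕ using (ℕ; zero; suc; _≤_; _∸_; z≤n; s≤s)
import Data.Nat.Properties as ℕ
open import Data.Product.Base using (_×_; _,_; proj₁; proj₂)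
open import Data.Sum.Base using ([_,_]′)
open import Data.Vec.Base as Vec using (Vec; []; _∷_; lookup; here; there)
import Data.Vec.Properties as Vec
open import Function.Base using (id; _∘_; const)
open import Function.Bundles using (mk⇔)
open import Relation.Binary.Bundles using (Setoid; DecSetoid)
import Relation.Binary.Construct.Closure.Equivalence as Eq
open import Relation.Binary.PropositionalEquality as ≡ using (_≡_; cong; cong₂)
open import Relation.Nullary using (yes; no; ¬_; ¬?; does; contradiction)
open import Relation.Nullary.Decidable using (dec-true; does-⇔; _×-dec_)
open import Relation.Unary using (Pred; Decidable)

-- Transversals of an equivalence relation.

module _ {a ℓ} (S : Setoid a ℓ) where

  open Setoid S using (sym; trans) renaming (_≈_ to _∼_)
  open import Data.List.Membership.Setoid S using (_∈_)

  ∈-─ : ∀ {u v ys} (u∈ys : u ∈ ys) → ¬ u ∼ v → v ∈ ys → v ∈ (ys ─ u∈ys)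
  ∈-─ (here u∼y)   u≁v (here v∼y)   = contradiction (trans u∼y (sym v∼y)) u≁v
  ∈-─ (here u∼y)   u≁v (there v∈ys) = v∈ys
  ∈-─ (there u∈ys) u≁v (here v∼y)   = here v∼y
  ∈-─ (there u∈ys) u≁v (there v∈ys) = there (∈-─ u∈ys u≁v v∈ys)

  -- Pigeonhole: the partner of the head of `xs` is deleted from `ys`, and the rest of `xs` keeps
  -- its partners because its entries are inequivalent to the head.
  unique⇒length≤ : ∀ {xs ys} → Unique S xs → All (_∈ ys) xs → length xs ≤ length ys
  unique⇒length≤ []         []             = z≤n
  unique⇒length≤ {ys = ys} (x∉xs ∷ xs!) (x∈ys ∷ xs⊆ys) = ℕ.≤-trans
    (s≤s (unique⇒length≤ xs! (All.zipWith (λ (x≁u , u∈ys) → ∈-─ x∈ys x≁u u∈ys) (x∉xs , xs⊆ys))))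
    (ℕ.≤-reflexive (≡.sym (List.length-removeAt′ ys (index x∈ys))))

  -- Lets any convenient transversal replace the one that `deduplicate` computes when components are
  -- counted.
  transversals-equinumerous : ∀ {xs ys} → Unique S xs → IsEnumeration S xs →
    Unique S ys → IsEnumeration S ys → length xs ≡ length ys
  transversals-equinumerous xs! _∈xs ys! _∈ys = ℕ.≤-antisym
    (unique⇒length≤ xs! (All.universal _∈ys _))
    (unique⇒length≤ ys! (All.universal _∈xs _))

-- Components and rank of a spanning subgraph.

module _ {v : ℕ} where

  open Connectivity {v} renaming (Connected to Linked; connected? to linked?)

  private
    Edges : ℕ → Set
    Edges = Vec (Fin v × Fin v)

    variable
      m m′ : ℕ

  connectivity : Edges m → Subset m → DecSetoid _ _
  connectivity es H = record
    { _≈_              = Linked es H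
    ; isDecEquivalence = record
      { isEquivalence = Eq.isEquivalence (Adjacent es H)
      ; _≟_           = linked? es H
      }
    }

  components : Edges m → Subset m → List (Fin v)
  components es H = List.deduplicate (linked? es H) (List.allFin v)

  module _ (es : Edges m) (H : Subset m) where

    open DecSetoid (connectivity es H) using (setoid; refl)

    components-! : Unique setoid (components es H)
    components-! = deduplicate-! (connectivity es H) (List.allFin v)

    components-enumerate : IsEnumeration setoid (components es H)
    components-enumerate = Enumerates.deduplicate⁺ (connectivity es H)
      λ u → Any.map (λ { ≡.refl → refl }) (∈-allFin u)

    length-transversal : ∀ {us} → Unique setoid us → IsEnumeration setoid us →
                         length us ≡ length (components es H)
    length-transversal us! _∈us =
      transversals-equinumerous setoid us! _∈us components-! components-enumerate

  length-components-cong : (es : Edges m) (H : Subset m) (es′ : Edges m′) (H′ : Subset m′) →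
    (∀ {u w} → Linked es H u w → Linked es′ H′ u w) →
    (∀ {u w} → Linked es′ H′ u w → Linked es H u w) →
    length (components es H) ≡ length (components es′ H′)
  length-components-cong es H es′ H′ to from = length-transversal es′ H′
    (AllPairs.map (_∘ from) (components-! es H))
    (Any.map to ∘ components-enumerate es H)

  -- Kruskal's algorithm runs from the last edge to the first: an edge counts when the chosen edges
  -- after it do not already join its ends. Being recursive in the edge vector, this form suits the
  -- induction for glued graphs.
  rank : Edges m → Subset m → ℕ
  rank []             []            = 0
  rank (_ ∷ es)       (outside ∷ H) = rank es H
  rank ((a , b) ∷ es) (inside ∷ H)  =
    if does (linked? es H a b) then rank es H else suc (rank es H)

  module _ (es : Edges m) (H : Subset m) (a b : Fin v) where

    private
      es⁺ = (a , b) ∷ es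
      H⁺  = inside ∷ H
      contr = contract es H a b (linked? es H)
      module S  = DecSetoid (connectivity es H)
      module S⁺ = DecSetoid (connectivity es⁺ H⁺)

    -- An edge with both ends in one component leaves the generated equivalence unchanged.
    length-components-joined : a S.≈ b → length (components es H) ≡ length (components es⁺ H⁺)
    length-components-joined a~b = length-components-cong es H es⁺ H⁺ weaken
      (Eq.fold S.isEquivalence λ where
        (zero  , _         , ≡.refl) → a~b
        (suc e , there e∈H , eq)     → Eq.return (e , e∈H , eq))

    -- A transversal of the merged classes, moved off the class of b, misses exactly that class.
    length-components-separated : ¬ a S.≈ b →
      length (components es H) ≡ suc (length (components es⁺ H⁺))
    length-components-separated a≁b = ≡.trans
      (≡.sym (length-transversal es H {b ∷ List.map contr (components es⁺ H⁺)}
        (All.map⁺ (All.universal b≁contract (components es⁺ H⁺))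
          ∷ Unique.map⁺ S⁺.setoid S.setoid (contract⁻ es H a b (linked? es H)) (components-! es⁺ H⁺))
        enumerate))
      (cong suc (List.length-map contr (components es⁺ H⁺)))
      where
      b≁contract : ∀ u → ¬ b S.≈ contr u
      b≁contract u with linked? es H u b
      ... | yes _   = a≁b ∘ S.sym
      ... | no  u≁b = u≁b ∘ S.sym

      contract-fixes : ∀ u → ¬ u S.≈ b → contr u S.≈ u
      contract-fixes u u≁b with linked? es H u b
      ... | yes u~b = contradiction u~b u≁b
      ... | no  _   = S.refl

      enumerate : IsEnumeration S.setoid (b ∷ List.map contr (components es⁺ H⁺))
      enumerate u with linked? es H u b
      ... | yes u~b = here u~b
      ... | no  u≁b = there (Any.map⁺ (Any.map
        (λ u~w → S.trans (S.sym (contract-fixes u u≁b)) (contract⁺ es H a b (linked? es H) u~w))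
        (components-enumerate es⁺ H⁺ u)))

  -- Each accepted edge merges two components and each rejected one merges none, starting from `v`
  -- isolated vertices.
  rank-+-components : (es : Edges m) (H : Subset m) → rank es H ℕ.+ length (components es H) ≡ v
  -- Without edges connectedness is equality, so the list of all vertices is itself a transversal.
  rank-+-components [] [] = ≡.trans
    (≡.sym (length-transversal [] []
      (AllPairs.map (_∘ Eq.fold ≡.isEquivalence λ ()) (allFin⁺ v))
      (λ u → Any.map (λ { ≡.refl → Eq.reflexive _ }) (∈-allFin u))))
    (List.length-tabulate id)
  rank-+-components (e ∷ es) (outside ∷ H) = ≡.trans
    (cong (rank es H ℕ.+_) (length-components-cong (e ∷ es) (outside ∷ H) es H
      (Eq.map λ { (suc i , there i∈H , eq) → i , i∈H , eq }) weaken))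
    (rank-+-components es H)
  rank-+-components ((a , b) ∷ es) (inside ∷ H) with linked? es H a b
  ... | yes a~b = ≡.trans
    (cong (rank es H ℕ.+_) (≡.sym (length-components-joined es H a b a~b)))
    (rank-+-components es H)
  ... | no a≁b = ≡.trans
    (≡.sym (ℕ.+-suc (rank es H) _))
    (≡.trans (cong (rank es H ℕ.+_) (≡.sym (length-components-separated es H a b a≁b)))
      (rank-+-components es H))

  -- Makes the truncated subtraction in the nullity exact, as additivity over the copies requires.
  rank≤∣H∣ : (es : Edges m) (H : Subset m) → rank es H ≤ ∣ H ∣
  rank≤∣H∣ []             []            = z≤n
  rank≤∣H∣ (_ ∷ es)       (outside ∷ H) = rank≤∣H∣ es H
  rank≤∣H∣ ((a , b) ∷ es) (inside ∷ H) with does (linked? es H a b)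
  ... | true  = ℕ.m≤n⇒m≤1+n (rank≤∣H∣ es H)
  ... | false = s≤s (rank≤∣H∣ es H)

module _ (G : Graph) where

  open Graph G

  r≡rank : ∀ H → r G H ≡ rank ends H
  r≡rank H = ≡.trans
    (cong (_∸ k G H) (≡.sym (rank-+-components ends H)))
    (ℕ.m+n∸n≡m (rank ends H) (k G H))

-- Two copies glued at a vertex.

module Gluing (G : TwoTerminalGraph) where

  open TwoTerminalGraph G
  open Double G hiding (double)
  open Connectivity renaming (Connected to Linked; connected? to linked?)

  private
    Edges : ℕ → Set
    Edges = Vec (Fin (suc others) × Fin (suc others))

    variable
      m m′ : ℕ

  -- The other copy collapses to the shared vertex, which is `Y` of the first copy and `X` of the
  -- second; `splitAt` counts it with the first.
  retract₁ retract₂ : Fin (suc others ℕ.+ others) → Fin (suc others)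
  retract₁ = [ id , const Y ]′ ∘ splitAt (suc others)
  retract₂ = [ const X , suc ]′ ∘ splitAt (suc others)

  retract₁-copy₁ : ∀ u → retract₁ (copy₁ u) ≡ u
  retract₁-copy₁ u rewrite Fin.splitAt-↑ˡ (suc others) u others = ≡.refl

  retract₂-copy₁ : ∀ u → retract₂ (copy₁ u) ≡ X
  retract₂-copy₁ u rewrite Fin.splitAt-↑ˡ (suc others) u others = ≡.refl

  retract₁-copy₂ : ∀ u → retract₁ (copy₂ u) ≡ Y
  retract₁-copy₂ zero    = retract₁-copy₁ Y
  retract₁-copy₂ (suc u) rewrite Fin.splitAt-↑ʳ (suc others) others u = ≡.refl

  retract₂-copy₂ : ∀ u → retract₂ (copy₂ u) ≡ u
  retract₂-copy₂ zero    = retract₂-copy₁ Y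
  retract₂-copy₂ (suc u) rewrite Fin.splitAt-↑ʳ (suc others) others u = ≡.refl

  -- The two edge vectors may differ, so that an induction can shorten one at a time.
  glue : Edges m → Edges m′ → Vec (Fin (suc others ℕ.+ others) × Fin (suc others ℕ.+ others)) (m ℕ.+ m′)
  glue es₁ es₂ = Vec.map (both copy₁) es₁ Vec.++ Vec.map (both copy₂) es₂

  adjacent-copy₁ : ∀ (es₁ : Edges m) H₁ (es₂ : Edges m′) H₂ {a b} → Adjacent es₁ H₁ a b →
    Adjacent (glue es₁ es₂) (H₁ Vec.++ H₂) (copy₁ a) (copy₁ b)
  adjacent-copy₁ (e ∷ es₁) (s ∷ H₁) es₂ H₂ (zero  , here      , ≡.refl) = zero , here , ≡.refl
  adjacent-copy₁ (e ∷ es₁) (s ∷ H₁) es₂ H₂ (suc i , there i∈H , eq)     =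
    let j , j∈H , eq′ = adjacent-copy₁ es₁ H₁ es₂ H₂ (i , i∈H , eq) in suc j , there j∈H , eq′

  adjacent-copy₂ : ∀ (es₁ : Edges m) H₁ (es₂ : Edges m′) H₂ {a b} → Adjacent es₂ H₂ a b →
    Adjacent (glue es₁ es₂) (H₁ Vec.++ H₂) (copy₂ a) (copy₂ b)
  adjacent-copy₂ []        []       es₂ H₂ (i , i∈H , eq) =
    i , i∈H , ≡.trans (Vec.lookup-map i (both copy₂) es₂) (cong (both copy₂) eq)
  adjacent-copy₂ (e ∷ es₁) (s ∷ H₁) es₂ H₂ adj =
    let j , j∈H , eq = adjacent-copy₂ es₁ H₁ es₂ H₂ adj in suc j , there j∈H , eq

  -- An edge of the first copy retracts to itself and an edge of the second to the vertex `Y`, so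
  -- paths in the glued graph project to paths in the copy.
  linked-retract₁ : ∀ (es₁ : Edges m) H₁ (es₂ : Edges m′) H₂ {a b} →
    Adjacent (glue es₁ es₂) (H₁ Vec.++ H₂) a b → Linked es₁ H₁ (retract₁ a) (retract₁ b)
  linked-retract₁ [] [] es₂ H₂ (i , _ , eq)
    with ≡.refl ← ≡.trans (≡.sym (Vec.lookup-map i (both copy₂) es₂)) eq =
    ≡.subst₂ (Linked [] [])
      (≡.sym (retract₁-copy₂ (proj₁ (lookup es₂ i)))) (≡.sym (retract₁-copy₂ (proj₂ (lookup es₂ i))))
      (Eq.reflexive _)
  linked-retract₁ (e ∷ es₁) (s ∷ H₁) es₂ H₂ (zero , here , ≡.refl) =
    Eq.return (zero , here , ≡.sym (cong₂ _,_ (retract₁-copy₁ _) (retract₁-copy₁ _)))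
  linked-retract₁ (e ∷ es₁) (s ∷ H₁) es₂ H₂ (suc i , there i∈H , eq) =
    weaken (linked-retract₁ es₁ H₁ es₂ H₂ (i , i∈H , eq))

  linked-retract₂ : ∀ (es₁ : Edges m) H₁ (es₂ : Edges m′) H₂ {a b} →
    Adjacent (glue es₁ es₂) (H₁ Vec.++ H₂) a b → Linked es₂ H₂ (retract₂ a) (retract₂ b)
  linked-retract₂ [] [] es₂ H₂ (i , i∈H , eq)
    with ≡.refl ← ≡.trans (≡.sym (Vec.lookup-map i (both copy₂) es₂)) eq =
    Eq.return (i , i∈H , ≡.sym (cong₂ _,_ (retract₂-copy₂ _) (retract₂-copy₂ _)))
  linked-retract₂ ((u , w) ∷ es₁) (s ∷ H₁) es₂ H₂ (zero , here , ≡.refl) =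
    ≡.subst₂ (Linked es₂ H₂) (≡.sym (retract₂-copy₁ u)) (≡.sym (retract₂-copy₁ w)) (Eq.reflexive _)
  linked-retract₂ (e ∷ es₁) (s ∷ H₁) es₂ H₂ (suc i , there i∈H , eq) =
    linked-retract₂ es₁ H₁ es₂ H₂ (i , i∈H , eq)

  module _ (es₁ : Edges m) (H₁ : Subset m) (es₂ : Edges m′) (H₂ : Subset m′) where

    private
      es = glue es₁ es₂
      H  = H₁ Vec.++ H₂

    -- Inclusion gives one direction and retraction the other. The form with `does` allows rewriting
    -- the test inside `rank`.
    does-linked-copy₁ : ∀ u w →
      does (linked? es H (copy₁ u) (copy₁ w)) ≡ does (linked? es₁ H₁ u w)
    does-linked-copy₁ u w = does-⇔ (mk⇔
      (≡.subst₂ (Linked es₁ H₁) (retract₁-copy₁ u) (retract₁-copy₁ w)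
        ∘ Eq.gfold (Eq.isEquivalence _) retract₁ (linked-retract₁ es₁ H₁ es₂ H₂))
      (Eq.gmap copy₁ (adjacent-copy₁ es₁ H₁ es₂ H₂)))
      (linked? es H (copy₁ u) (copy₁ w)) (linked? es₁ H₁ u w)

    does-linked-copy₂ : ∀ u w →
      does (linked? es H (copy₂ u) (copy₂ w)) ≡ does (linked? es₂ H₂ u w)
    does-linked-copy₂ u w = does-⇔ (mk⇔
      (≡.subst₂ (Linked es₂ H₂) (retract₂-copy₂ u) (retract₂-copy₂ w)
        ∘ Eq.gfold (Eq.isEquivalence _) retract₂ (linked-retract₂ es₁ H₁ es₂ H₂))
      (Eq.gmap copy₂ (adjacent-copy₂ es₁ H₁ es₂ H₂)))
      (linked? es H (copy₂ u) (copy₂ w)) (linked? es₂ H₂ u w)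

    -- copy₁ Y and copy₂ X are the same vertex.
    does-linked-across : does (linked? es H (copy₁ X) (copy₂ Y)) ≡
                         does (linked? es₁ H₁ X Y) ∧ does (linked? es₂ H₂ X Y)
    does-linked-across = does-⇔ (mk⇔
      (λ X~Y →
        ≡.subst₂ (Linked es₁ H₁) (retract₁-copy₁ X) (retract₁-copy₂ Y)
          (Eq.gfold (Eq.isEquivalence _) retract₁ (linked-retract₁ es₁ H₁ es₂ H₂) X~Y)
      , ≡.subst₂ (Linked es₂ H₂) (retract₂-copy₁ X) (retract₂-copy₂ Y)
          (Eq.gfold (Eq.isEquivalence _) retract₂ (linked-retract₂ es₁ H₁ es₂ H₂) X~Y))
      (λ (X~Y₁ , X~Y₂) → Eq.transitive (Adjacent es H)
        (Eq.gmap copy₁ (adjacent-copy₁ es₁ H₁ es₂ H₂) X~Y₁)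
        (Eq.gmap copy₂ (adjacent-copy₂ es₁ H₁ es₂ H₂) X~Y₂)))
      (linked? es H (copy₁ X) (copy₂ Y)) (linked? es₁ H₁ X Y ×-dec linked? es₂ H₂ X Y)

  -- Each edge is accepted in the glued graph exactly when it is accepted in its own copy: the
  -- second copy is processed first, but joins no further vertices of the first.
  rank-glue : ∀ (es₁ : Edges m) H₁ (es₂ : Edges m′) H₂ →
    rank (glue es₁ es₂) (H₁ Vec.++ H₂) ≡ rank es₁ H₁ ℕ.+ rank es₂ H₂
  rank-glue [] [] [] [] = ≡.refl
  rank-glue [] [] (e ∷ es₂) (outside ∷ H₂) = rank-glue [] [] es₂ H₂
  rank-glue [] [] ((u , w) ∷ es₂) (inside ∷ H₂)
    rewrite does-linked-copy₂ [] [] es₂ H₂ u w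
    with does (linked? es₂ H₂ u w)
  ... | true  = rank-glue [] [] es₂ H₂
  ... | false = cong suc (rank-glue [] [] es₂ H₂)
  rank-glue (e ∷ es₁) (outside ∷ H₁) es₂ H₂ = rank-glue es₁ H₁ es₂ H₂
  rank-glue ((u , w) ∷ es₁) (inside ∷ H₁) es₂ H₂
    rewrite does-linked-copy₁ es₁ H₁ es₂ H₂ u w
    with does (linked? es₁ H₁ u w)
  ... | true  = rank-glue es₁ H₁ es₂ H₂
  ... | false = cong suc (rank-glue es₁ H₁ es₂ H₂)

-- Ring identities behind the recursions.

module RingIdentities {c ℓ} (R : CommutativeRing c ℓ) where

  open CommutativeRing R
    using ( Carrier; refl; trans; +-cong; +-congʳ; +-congˡ; *-cong; *-congˡ; *-congʳ
          ; semiring; commutativeSemiring)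
    renaming (_≈_ to _≈R_; _+_ to _+R_; _*_ to _*R_; 0# to 0R)
  open SemiringExp semiring using () renaming (_^_ to _^R_)
  open SemiringMult semiring using () renaming (_×_ to _·R_)
  open RingSolver commutativeSemiring

  restrict : Bool → Carrier → Carrier
  restrict b p = if b then p else 0R

  -- t and u are the weights of the two copies, p and q those of their union without and with
  -- the new edge.
  module _ (t u p q : Carrier) (p≈tu : p ≈R t *R u) where

    private
      -- The three ways in which at least one copy separates its special vertices; for given `b` and
      -- `c` at most one summand remains.
      cross : Bool → Bool → Carrier
      cross b c = restrict b t *R restrict (not c) u +R restrict (not b) t *R restrict c u
                  +R restrict (not b) t *R restrict (not c) u

      only-inside : ∀ z → z *R q ≈R p → z *R (0R +R q) ≈R t *R u
      only-inside z zq≈p = trans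
        (solve 2 (λ z q → z :* (con 0 :+ q) := z :* q) refl z q) (trans zq≈p p≈tu)

    -- The new edge always joins the special vertices, hence `not true`; without it they are
    -- separated unless both copies join them.
    separated-weights : ∀ b c → restrict (not (b ∧ c)) p +R restrict (not true) q ≈R cross b c
    separated-weights true true =
      solve 2 (λ t u → con 0 :+ con 0 := t :* con 0 :+ con 0 :* u :+ con 0 :* con 0) refl t u
    separated-weights true false = trans (+-congʳ p≈tu)
      (solve 2 (λ t u → t :* u :+ con 0 := t :* u :+ con 0 :* con 0 :+ con 0 :* u) refl t u)
    separated-weights false true = trans (+-congʳ p≈tu)
      (solve 2 (λ t u → t :* u :+ con 0 := con 0 :* con 0 :+ t :* u :+ t :* con 0) refl t u)
    separated-weights false false = trans (+-congʳ p≈tu)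
      (solve 2 (λ t u → t :* u :+ con 0 := con 0 :* u :+ t :* con 0 :+ t :* u) refl t u)

    -- If both copies are joined, the subgraphs without and with the new edge both count, which
    -- gives the factor `y`. Otherwise only the latter counts, and its weight is given only through
    -- `z *R q`; hence the multiplication of the whole identity by `z`.
    joined-weights : ∀ z y b c →
      (b ∧ c ≡ true → p +R q ≈R y *R p) → (b ∧ c ≡ false → z *R q ≈R p) →
      z *R (restrict (b ∧ c) p +R restrict true q) ≈R
      z *R y *R (restrict b t *R restrict c u) +R cross b c
    joined-weights z y true true p+q≈yp _ = trans
      (*-congˡ (trans (p+q≈yp ≡.refl) (*-congˡ p≈tu)))
      (solve 4 (λ z y t u → z :* (y :* (t :* u)) :=
        z :* y :* (t :* u) :+ (t :* con 0 :+ con 0 :* u :+ con 0 :* con 0)) refl z y t u)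
    joined-weights z y true false _ zq≈p = trans (only-inside z (zq≈p ≡.refl))
      (solve 4 (λ z y t u → t :* u :=
        z :* y :* (t :* con 0) :+ (t :* u :+ con 0 :* con 0 :+ con 0 :* u)) refl z y t u)
    joined-weights z y false true _ zq≈p = trans (only-inside z (zq≈p ≡.refl))
      (solve 4 (λ z y t u → t :* u :=
        z :* y :* (con 0 :* u) :+ (con 0 :* con 0 :+ t :* u :+ t :* con 0)) refl z y t u)
    joined-weights z y false false _ zq≈p = trans (only-inside z (zq≈p ≡.refl))
      (solve 4 (λ z y t u → t :* u :=
        z :* y :* (con 0 :* con 0) :+ (con 0 :* u :+ t :* con 0 :+ t :* u)) refl z y t u)

  module _ {z u n : Carrier} (u≈zn : u ≈R z *R n) (t : Carrier) where

    -- For `u` = `T₂`, `n` = `N` and `z` = x - 1: the substitution exposes the factor `z` that is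
    -- cancelled at the end.
    N-recursion-scaled : t *R u +R u *R t +R u *R u ≈R z *R (2 ·R (t *R n) +R z *R n ^R 2)
    N-recursion-scaled = trans
      (+-cong (+-cong (*-congˡ u≈zn) (*-congʳ u≈zn)) (*-cong u≈zn u≈zn))
      -- The `con 0` and `con 1` come from unfolding `2 ·R` and `^R 2`.
      (solve 3 (λ z n t → t :* (z :* n) :+ z :* n :* t :+ z :* n :* (z :* n) :=
         z :* (t :* n :+ (t :* n :+ con 0) :+ z :* (n :* (n :* con 1)))) refl z n t)

    T₁-recursion-scaled : ∀ y → z *R y *R (t *R t) +R (t *R u +R u *R t +R u *R u) ≈R
      z *R (y *R t ^R 2 +R 2 ·R (t *R n) +R z *R n ^R 2)
    T₁-recursion-scaled y = trans (+-congˡ N-recursion-scaled)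
      (solve 4 (λ z y n t → z :* y :* (t :* t)
          :+ z :* (t :* n :+ (t :* n :+ con 0) :+ z :* (n :* (n :* con 1))) :=
         z :* (y :* (t :* (t :* con 1)) :+ (t :* n :+ (t :* n :+ con 0)) :+ z :* (n :* (n :* con 1))))
        refl z y n t)

-- Finite sums over lists and edge subsets.

module K = CommutativeRing ℤ[x,y]
open import Relation.Binary.Reasoning.Setoid K.setoid
open RingIdentities ℤ[x,y]
open CommutativeSemigroupProperties K.+-commutativeSemigroup using ()
  renaming (interchange to +-interchange)
open CommutativeSemigroupProperties K.*-commutativeSemigroup using (x∙yz≈y∙xz)
  renaming (interchange to *-interchange)
open AbelianGroupProperties K.+-abelianGroup using (xyx⁻¹≈y)
open SemiringExp K.semiring using (^-homo-*)

module _ {a} {A : Set a} where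

  ∑-cong : ∀ (as : List A) {f g} → (∀ a → f a ≈ g a) → ∑ as f ≈ ∑ as g
  ∑-cong []       f≈g = K.refl
  ∑-cong (a ∷ as) f≈g = K.+-cong (f≈g a) (∑-cong as f≈g)

  ∑-distrib-+ : ∀ (as : List A) f g → ∑ as (λ a → f a + g a) ≈ ∑ as f + ∑ as g
  ∑-distrib-+ []       f g = K.sym (K.+-identityʳ 0#)
  ∑-distrib-+ (a ∷ as) f g = K.trans (K.+-congˡ (∑-distrib-+ as f g))
    (+-interchange (f a) (g a) (∑ as f) (∑ as g))

  *-distribˡ-∑ : ∀ c (as : List A) f → c * ∑ as f ≈ ∑ as (λ a → c * f a)
  *-distribˡ-∑ c []       f = K.zeroʳ c
  *-distribˡ-∑ c (a ∷ as) f = K.trans (K.distribˡ c (f a) (∑ as f)) (K.+-congˡ (*-distribˡ-∑ c as f))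

  *-distribʳ-∑ : ∀ c (as : List A) f → ∑ as f * c ≈ ∑ as (λ a → f a * c)
  *-distribʳ-∑ c []       f = K.zeroˡ c
  *-distribʳ-∑ c (a ∷ as) f = K.trans (K.distribʳ c (f a) (∑ as f)) (K.+-congˡ (*-distribʳ-∑ c as f))

  ∑-++ : ∀ (as bs : List A) f → ∑ (as List.++ bs) f ≈ ∑ as f + ∑ bs f
  ∑-++ []       bs f = K.sym (K.+-identityˡ _)
  ∑-++ (a ∷ as) bs f = K.trans (K.+-congˡ (∑-++ as bs f)) (K.sym (K.+-assoc (f a) (∑ as f) (∑ bs f)))

  ∑-map : ∀ {b} {B : Set b} (g : B → A) bs f → ∑ (List.map g bs) f ≡ ∑ bs (f ∘ g)
  ∑-map g []       f = ≡.refl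
  ∑-map g (b ∷ bs) f = cong (f (g b) +_) (∑-map g bs f)

  -- Trades the condition for an indicator weight, so that the partial sums run over all subsets.
  ∑-filter : ∀ {p} {P : Pred A p} (P? : Decidable P) as f →
             ∑ (List.filter P? as) f ≈ ∑ as (λ a → restrict (does (P? a)) (f a))
  ∑-filter P? []       f = K.refl
  ∑-filter P? (a ∷ as) f with does (P? a)
  ... | true  = K.+-congˡ (∑-filter P? as f)
  ... | false = K.trans (∑-filter P? as f) (K.sym (K.+-identityˡ _))

∑-subsets-suc : ∀ m f → ∑ (subsets (suc m)) f ≈
                ∑ (subsets m) (f ∘ (outside ∷_)) + ∑ (subsets m) (f ∘ (inside ∷_))
∑-subsets-suc m f = begin
  -- The final `[]` is left by `cartesianProductWith` on a two-element list.
  ∑ (List.map (outside ∷_) Hs List.++ List.map (inside ∷_) Hs List.++ []) f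
    ≈⟨ ∑-++ (List.map (outside ∷_) Hs) _ f ⟩
  ∑ (List.map (outside ∷_) Hs) f + ∑ (List.map (inside ∷_) Hs List.++ []) f
    ≡⟨ cong₂ (λ p Js → p + ∑ Js f) (∑-map (outside ∷_) Hs f)
         (List.++-identityʳ (List.map (inside ∷_) Hs)) ⟩
  ∑ Hs (f ∘ (outside ∷_)) + ∑ (List.map (inside ∷_) Hs) f
    ≡⟨ cong (∑ Hs (f ∘ (outside ∷_)) +_) (∑-map (inside ∷_) Hs f) ⟩
  ∑ Hs (f ∘ (outside ∷_)) + ∑ Hs (f ∘ (inside ∷_)) ∎
  where Hs = subsets m

∑-subsets-++ : ∀ m n f → ∑ (subsets (m ℕ.+ n)) f ≈
               ∑ (subsets m) (λ H → ∑ (subsets n) (λ J → f (H Vec.++ J)))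
∑-subsets-++ zero    n f = K.sym (K.+-identityʳ _)
∑-subsets-++ (suc m) n f = begin
  ∑ (subsets (suc m ℕ.+ n)) f
    ≈⟨ ∑-subsets-suc (m ℕ.+ n) f ⟩
  ∑ (subsets (m ℕ.+ n)) (f ∘ (outside ∷_)) + ∑ (subsets (m ℕ.+ n)) (f ∘ (inside ∷_))
    ≈⟨ K.+-cong (∑-subsets-++ m n _) (∑-subsets-++ m n _) ⟩
  _ ≈⟨ ∑-subsets-suc m _ ⟨
  ∑ (subsets (suc m)) (λ H → ∑ (subsets n) (λ J → f (H Vec.++ J))) ∎

-- Cancellation of x - 1.

module _ {c ℓ} (R : CommutativeRing c ℓ) where

  open CommutativeRing R using (-_) renaming (1# to 1R; _≈_ to _≈R_; _+_ to _+R_; _*_ to _*R_)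
  private module R = CommutativeRing R
  open RingProperties R.ring using (-1*x≈-x)
  open AbelianGroupProperties R.+-abelianGroup using (⁻¹-injective; ∙-cancelʳ)
  open Polynomial R

  C-⊛-coeff : ∀ a p n → coeff (C a ⊛ p) n ≈R a *R coeff p n
  C-⊛-coeff a p zero    = ⊛-coeff (C a) p 0
  C-⊛-coeff a p (suc n) = R.trans (⊛-coeff (C a) p (suc n))
    (R.trans (R.+-congˡ (conv-zeroˡ (coeff p) n)) (R.+-identityʳ _))

  -1*-injective : ∀ {a b} → - 1R *R a ≈R - 1R *R b → a ≈R b
  -1*-injective {a} {b} eq =
    ⁻¹-injective (R.trans (R.sym (-1*x≈-x a)) (R.trans eq (-1*x≈-x b)))

  -- The constant coefficient -1 is a unit, so the coefficients of the product determine those of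
  -- the factor one after another.
  X-1-cancelˡ : ∀ p q → (- 1R ∷ 1R ∷ []) ⊛ p ≋ (- 1R ∷ 1R ∷ []) ⊛ q → p ≋ q
  X-1-cancelˡ p q eq = coeffwise go
    where
    step : ∀ p n → coeff ((- 1R ∷ 1R ∷ []) ⊛ p) (suc n) ≈R - 1R *R coeff p (suc n) +R coeff p n
    step p n = R.trans (⊛-coeff (- 1R ∷ 1R ∷ []) p (suc n))
      (R.+-congˡ (R.trans (R.sym (⊛-coeff (C 1R) p n)) (_≋_.at (⊛-identityˡ p) n)))

    go : ∀ n → coeff p n ≈R coeff q n
    go zero    = -1*-injective (R.trans (R.sym (⊛-coeff (- 1R ∷ 1R ∷ []) p 0))
      (R.trans (_≋_.at eq 0) (⊛-coeff (- 1R ∷ 1R ∷ []) q 0)))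
    -- By induction the contribution of degree `n` is the same on both sides and cancels.
    go (suc n) = -1*-injective (∙-cancelʳ (coeff q n) _ _
      (R.trans (R.+-congˡ (R.sym (go n)))
        (R.trans (R.sym (step p n)) (R.trans (_≋_.at eq (suc n)) (step q n)))))

-- x - 1 computes to the constant polynomial in y with coefficient -1 + x.
x-1-cancelˡ : ∀ p q → (x - 1#) * p ≈ (x - 1#) * q → p ≈ q
-- A factor constant in y acts on each coefficient separately, which reduces the claim to
-- polynomials in x.
x-1-cancelˡ p q eq = Polynomial.coeffwise λ n → X-1-cancelˡ ℤ.+-*-commutativeRing _ _
  (ℤ[x].trans (ℤ[x].sym (C-⊛-coeff ℤ[x] -1+X p n))
    (ℤ[x].trans (Polynomial._≋_.at eq n) (C-⊛-coeff ℤ[x] -1+X q n)))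
  where
  module ℤ[x] = CommutativeRing ℤ[x]
  -1+X = -1ℤ ∷ 1ℤ ∷ []

-- Double sums over pairs of subgraphs.

∑-product : ∀ {a b} {A : Set a} {B : Set b} (as : List A) (bs : List B) f g →
            ∑ as (λ a → ∑ bs (λ b → f a * g b)) ≈ ∑ as f * ∑ bs g
∑-product as bs f g = begin
  ∑ as (λ a → ∑ bs (λ b → f a * g b)) ≈⟨ ∑-cong as (λ a → *-distribˡ-∑ (f a) bs g) ⟨
  ∑ as (λ a → f a * ∑ bs g)           ≈⟨ *-distribʳ-∑ (∑ bs g) as f ⟨
  ∑ as f * ∑ bs g                     ∎

module _ {a b} {A : Set a} {B : Set b} (as : List A) (bs : List B) where

  ∑∑-cong : ∀ {f g : A → B → Poly[x,y]} → (∀ a b → f a b ≈ g a b) →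
            ∑ as (λ a → ∑ bs (f a)) ≈ ∑ as (λ a → ∑ bs (g a))
  ∑∑-cong f≈g = ∑-cong as (λ a → ∑-cong bs (f≈g a))

  ∑∑-distrib-+ : ∀ (f g : A → B → Poly[x,y]) →
    ∑ as (λ a → ∑ bs (λ b → f a b + g a b)) ≈ ∑ as (λ a → ∑ bs (f a)) + ∑ as (λ a → ∑ bs (g a))
  ∑∑-distrib-+ f g =
    K.trans (∑-cong as (λ a → ∑-distrib-+ bs (f a) (g a))) (∑-distrib-+ as _ _)

  *-distribˡ-∑∑ : ∀ c (f : A → B → Poly[x,y]) →
    c * ∑ as (λ a → ∑ bs (f a)) ≈ ∑ as (λ a → ∑ bs (λ b → c * f a b))
  *-distribˡ-∑∑ c f =
    K.trans (*-distribˡ-∑ c as _) (∑-cong as (λ a → *-distribˡ-∑ c bs (f a)))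

-- The new edge heads the edge vector of the doubled graph, followed by the edges of the two copies.
∑-subsets-double : ∀ m f → ∑ (subsets (suc (m ℕ.+ m))) f ≈
  ∑ (subsets m) (λ H → ∑ (subsets m) (λ J → f (outside ∷ H Vec.++ J) + f (inside ∷ H Vec.++ J)))
∑-subsets-double m f = begin
  ∑ (subsets (suc (m ℕ.+ m))) f
    ≈⟨ ∑-subsets-suc (m ℕ.+ m) f ⟩
  ∑ (subsets (m ℕ.+ m)) (f ∘ (outside ∷_)) + ∑ (subsets (m ℕ.+ m)) (f ∘ (inside ∷_))
    ≈⟨ K.+-cong (∑-subsets-++ m m (f ∘ (outside ∷_))) (∑-subsets-++ m m (f ∘ (inside ∷_))) ⟩
  ∑ (subsets m) (λ H → ∑ (subsets m) (λ J → f (outside ∷ H Vec.++ J)))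
    + ∑ (subsets m) (λ H → ∑ (subsets m) (λ J → f (inside ∷ H Vec.++ J)))
    ≈⟨ ∑∑-distrib-+ (subsets m) (subsets m) _ _ ⟨
  ∑ (subsets m) (λ H → ∑ (subsets m) (λ J → f (outside ∷ H Vec.++ J) + f (inside ∷ H Vec.++ J))) ∎

∣++∣ : ∀ {m n} (H : Subset m) (J : Subset n) → ∣ H Vec.++ J ∣ ≡ ∣ H ∣ ℕ.+ ∣ J ∣
∣++∣ []            J = ≡.refl
∣++∣ (outside ∷ H) J = ∣++∣ H J
∣++∣ (inside ∷ H)  J = cong suc (∣++∣ H J)

[m+n]∸[o+p] : ∀ {m n o p} → o ≤ m → p ≤ n → (m ℕ.+ n) ∸ (o ℕ.+ p) ≡ (m ∸ o) ℕ.+ (n ∸ p)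
[m+n]∸[o+p] {m} {n} {o} {p} o≤m p≤n = ≡.trans (≡.sym (ℕ.∸-+-assoc (m ℕ.+ n) o p))
  (≡.trans (cong (_∸ p) (ℕ.+-∸-comm n o≤m)) (ℕ.+-∸-assoc (m ∸ o) p≤n))

monomial : ℕ → ℕ → Poly[x,y]
monomial i j = (x - 1#) ^ i * (y - 1#) ^ j

monomial-+ : ∀ i i′ j j′ → monomial (i ℕ.+ i′) (j ℕ.+ j′) ≈ monomial i j * monomial i′ j′
monomial-+ i i′ j j′ = K.trans
  (K.*-cong (^-homo-* (x - 1#) i i′) (^-homo-* (y - 1#) j j′))
  (*-interchange ((x - 1#) ^ i) _ _ _)

-- Terms of the Tutte polynomial as monomials.

module _ (n : ℕ) where

  open TwoTerminalGraph (farey n)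

  -- Connectedness leaves at most one component; at least one exists by computation, since vertex
  -- zero survives `deduplicate`.
  r-⊤ : r graph ⊤ ≡ others
  r-⊤ = cong (suc others ∸_) (ℕ.≤-antisym (connected⇒k≤1 n (farey-connected n)) (s≤s z≤n))

  -- Makes the subtraction in the exponent of x - 1 exact; it holds because there is at least one
  -- component.
  rank≤others : ∀ H → rank ends H ≤ others
  rank≤others H = ≡.subst (_≤ others) (r≡rank graph H)
    (ℕ.∸-monoʳ-≤ {1} {k graph H} (suc others) (s≤s z≤n))

  term≡monomial : ∀ H → term graph H ≡ monomial (others ∸ rank ends H) (∣ H ∣ ∸ rank ends H)
  term≡monomial H = cong₂ (λ s ρ → monomial (s ∸ ρ) (∣ H ∣ ∸ ρ)) r-⊤ (r≡rank graph H)

  joined : Subset size → Bool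
  joined H = does (XYConnected? n H)

  weight₁ weight₂ : Subset size → Poly[x,y]
  weight₁ H = restrict (joined H) (term graph H)
  weight₂ H = restrict (not (joined H)) (term graph H)

  T₁-weight₁ : T₁ n ≈ ∑ (subsets size) weight₁
  T₁-weight₁ = ∑-filter (XYConnected? n) (subsets size) (term graph)

  T₂-weight₂ : T₂ n ≈ ∑ (subsets size) weight₂
  T₂-weight₂ = ∑-filter (¬? ∘ XYConnected? n) (subsets size) (term graph)

  Tutte-split : T n ≈ T₁ n + T₂ n
  Tutte-split = begin
    ∑ (subsets size) (term graph)
      ≈⟨ ∑-cong (subsets size) (λ H → split (joined H) (term graph H)) ⟩
    ∑ (subsets size) (λ H → weight₁ H + weight₂ H)
      ≈⟨ ∑-distrib-+ (subsets size) weight₁ weight₂ ⟩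
    ∑ (subsets size) weight₁ + ∑ (subsets size) weight₂
      ≈⟨ K.+-cong T₁-weight₁ T₂-weight₂ ⟨
    T₁ n + T₂ n ∎
    where
    split : ∀ b p → p ≈ restrict b p + restrict (not b) p
    split true  p = K.sym (K.+-identityʳ p)
    split false p = K.sym (K.+-identityˡ p)

-- Effect of the new edge on terms and partial sums.

module _ (n : ℕ) where

  open TwoTerminalGraph (farey n)
  open Gluing (farey n)
  private
    module G⁺ = TwoTerminalGraph (farey (suc n))
    Hs = subsets size
    z = x - 1#

  joined-inside : ∀ H → joined (suc n) (inside ∷ H) ≡ true
  joined-inside H = dec-true (XYConnected? (suc n) (inside ∷ H)) (Eq.return (zero , here , ≡.refl))

  joined-outside : ∀ H J → joined (suc n) (outside ∷ H Vec.++ J) ≡ joined n H ∧ joined n J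
  -- An absent head edge drops out of `does` by computation, leaving the glued copies.
  joined-outside H J = does-linked-across ends H ends J

  -- Without the new edge, vertices other than `X`, edges and ranks all add up over the copies,
  -- hence so do both exponents.
  term-outside : ∀ H J →
    term G⁺.graph (outside ∷ H Vec.++ J) ≈ term graph H * term graph J
  term-outside H J = begin
    term G⁺.graph (outside ∷ H Vec.++ J)
      ≡⟨ term≡monomial (suc n) (outside ∷ H Vec.++ J) ⟩
    monomial ((others ℕ.+ others) ∸ rank (glue ends ends) (H Vec.++ J))
             (∣ H Vec.++ J ∣ ∸ rank (glue ends ends) (H Vec.++ J))
      ≡⟨ cong₂ (λ c ρ → monomial ((others ℕ.+ others) ∸ ρ) (c ∸ ρ))
           (∣++∣ H J) (rank-glue ends H ends J) ⟩
    monomial ((others ℕ.+ others) ∸ (ρ H ℕ.+ ρ J)) ((∣ H ∣ ℕ.+ ∣ J ∣) ∸ (ρ H ℕ.+ ρ J))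
      ≡⟨ cong₂ monomial ([m+n]∸[o+p] (rank≤others n H) (rank≤others n J))
                        ([m+n]∸[o+p] (rank≤∣H∣ ends H) (rank≤∣H∣ ends J)) ⟩
    monomial ((others ∸ ρ H) ℕ.+ (others ∸ ρ J)) ((∣ H ∣ ∸ ρ H) ℕ.+ (∣ J ∣ ∸ ρ J))
      ≈⟨ monomial-+ (others ∸ ρ H) (others ∸ ρ J) (∣ H ∣ ∸ ρ H) (∣ J ∣ ∸ ρ J) ⟩
    monomial (others ∸ ρ H) (∣ H ∣ ∸ ρ H) * monomial (others ∸ ρ J) (∣ J ∣ ∸ ρ J)
      ≡⟨ cong₂ _*_ (term≡monomial n H) (term≡monomial n J) ⟨
    term graph H * term graph J ∎
    where ρ = rank ends

  module _ (H : Subset (size ℕ.+ size)) where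

    private
      ρ ρ⁺ : ℕ
      ρ  = rank G⁺.ends (outside ∷ H)
      ρ⁺ = rank G⁺.ends (inside ∷ H)

    -- The new edge closes a cycle: the rank stays and the nullity grows by one.
    term-inside-joined : joined (suc n) (outside ∷ H) ≡ true →
      term G⁺.graph (inside ∷ H) ≈ (y - 1#) * term G⁺.graph (outside ∷ H)
    term-inside-joined b = begin
      term G⁺.graph (inside ∷ H)
        ≡⟨ term≡monomial (suc n) (inside ∷ H) ⟩
      monomial (G⁺.others ∸ ρ⁺) (suc ∣ H ∣ ∸ ρ⁺)
        ≡⟨ cong (λ s → monomial (G⁺.others ∸ s) (suc ∣ H ∣ ∸ s)) ρ⁺≡ρ ⟩
      monomial (G⁺.others ∸ ρ) (suc ∣ H ∣ ∸ ρ)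
        ≡⟨ cong (monomial (G⁺.others ∸ ρ)) (ℕ.+-∸-assoc 1 (rank≤∣H∣ G⁺.ends (outside ∷ H))) ⟩
      z ^ (G⁺.others ∸ ρ) * ((y - 1#) * (y - 1#) ^ (∣ H ∣ ∸ ρ))
        ≈⟨ x∙yz≈y∙xz (z ^ (G⁺.others ∸ ρ)) (y - 1#) _ ⟩
      (y - 1#) * monomial (G⁺.others ∸ ρ) (∣ H ∣ ∸ ρ)
        ≡⟨ cong ((y - 1#) *_) (term≡monomial (suc n) (outside ∷ H)) ⟨
      (y - 1#) * term G⁺.graph (outside ∷ H) ∎
      where
      ρ⁺≡ρ : ρ⁺ ≡ ρ
      -- `ρ⁺` unfolds to this `if`, whose test is `joined` of the subgraph without the new edge.
      ρ⁺≡ρ = cong (λ b → if b then ρ else suc ρ) b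

    -- The new edge raises the rank and keeps the nullity, so the exponent of x - 1 drops by one;
    -- the factor `z` restores it.
    term-inside-separated : joined (suc n) (outside ∷ H) ≡ false →
      z * term G⁺.graph (inside ∷ H) ≈ term G⁺.graph (outside ∷ H)
    term-inside-separated b = begin
      z * term G⁺.graph (inside ∷ H)
        ≡⟨ cong (z *_) (term≡monomial (suc n) (inside ∷ H)) ⟩
      z * monomial (G⁺.others ∸ ρ⁺) (suc ∣ H ∣ ∸ ρ⁺)
        ≡⟨ cong (λ s → z * monomial (G⁺.others ∸ s) (suc ∣ H ∣ ∸ s)) ρ⁺≡suc-ρ ⟩
      z * monomial (G⁺.others ∸ suc ρ) (∣ H ∣ ∸ ρ)
        ≈⟨ K.*-assoc z (z ^ (G⁺.others ∸ suc ρ)) _ ⟨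
      monomial (suc (G⁺.others ∸ suc ρ)) (∣ H ∣ ∸ ρ)
        -- The rank bound for the subgraph with the new edge supplies `suc ρ ≤ G⁺.others`, so no
        -- truncation occurs.
        ≡⟨ cong (λ i → monomial i (∣ H ∣ ∸ ρ))
             (ℕ.+-∸-assoc 1 (≡.subst (_≤ G⁺.others) ρ⁺≡suc-ρ (rank≤others (suc n) (inside ∷ H)))) ⟨
      monomial (G⁺.others ∸ ρ) (∣ H ∣ ∸ ρ)
        ≡⟨ term≡monomial (suc n) (outside ∷ H) ⟨
      term G⁺.graph (outside ∷ H) ∎
      where
      ρ⁺≡suc-ρ : ρ⁺ ≡ suc ρ
      ρ⁺≡suc-ρ = cong (λ b → if b then ρ else suc ρ) b

  private
    w₁ w₂ : Subset size → Poly[x,y]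
    w₁ = weight₁ n
    w₂ = weight₂ n

    w₁≈ = T₁-weight₁ n
    w₂≈ = T₂-weight₂ n

    product : ∀ {p q f g} → p ≈ ∑ Hs f → q ≈ ∑ Hs g → ∑ Hs (λ H → ∑ Hs (λ J → f H * g J)) ≈ p * q
    product {f = f} {g} p≈ q≈ = K.trans (∑-product Hs Hs f g) (K.sym (K.*-cong p≈ q≈))

    cross : Subset size → Subset size → Poly[x,y]
    cross H J = w₁ H * w₂ J + w₂ H * w₁ J + w₂ H * w₂ J

  module _ (H J : Subset size) where

    private
      p q : Poly[x,y]
      p = term G⁺.graph (outside ∷ H Vec.++ J)
      q = term G⁺.graph (inside ∷ H Vec.++ J)

    weight₁-double :
      z * (weight₁ (suc n) (outside ∷ H Vec.++ J) + weight₁ (suc n) (inside ∷ H Vec.++ J)) ≈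
      z * y * (w₁ H * w₁ J) + cross H J
    weight₁-double = begin
      z * (restrict (joined (suc n) (outside ∷ H Vec.++ J)) p
           + restrict (joined (suc n) (inside ∷ H Vec.++ J)) q)
        ≡⟨ cong₂ (λ b c → z * (restrict b p + restrict c q))
             (joined-outside H J) (joined-inside (H Vec.++ J)) ⟩
      z * (restrict (joined n H ∧ joined n J) p + restrict true q)
        ≈⟨ joined-weights (term graph H) (term graph J) p q (term-outside H J) z y
             (joined n H) (joined n J)
             (λ b → +-[y-1]* (term-inside-joined (H Vec.++ J) (≡.trans (joined-outside H J) b)))
             (λ b → term-inside-separated (H Vec.++ J) (≡.trans (joined-outside H J) b)) ⟩
      z * y * (w₁ H * w₁ J) + cross H J ∎
      where
      +-[y-1]* : q ≈ (y - 1#) * p → p + q ≈ y * p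
      +-[y-1]* q≈ = begin
        p + q                   ≈⟨ K.+-cong (K.sym (K.*-identityˡ p)) q≈ ⟩
        1# * p + (y - 1#) * p   ≈⟨ K.distribʳ p 1# (y - 1#) ⟨
        (1# + (y - 1#)) * p     ≈⟨ K.*-congʳ (xyx⁻¹≈y 1# y) ⟩
        y * p                   ∎

    weight₂-double :
      weight₂ (suc n) (outside ∷ H Vec.++ J) + weight₂ (suc n) (inside ∷ H Vec.++ J) ≈ cross H J
    weight₂-double = begin
      restrict (not (joined (suc n) (outside ∷ H Vec.++ J))) p
        + restrict (not (joined (suc n) (inside ∷ H Vec.++ J))) q
        ≡⟨ cong₂ (λ b c → restrict (not b) p + restrict (not c) q)
             (joined-outside H J) (joined-inside (H Vec.++ J)) ⟩
      restrict (not (joined n H ∧ joined n J)) p + restrict (not true) q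
        ≈⟨ separated-weights (term graph H) (term graph J) p q (term-outside H J)
             (joined n H) (joined n J) ⟩
      cross H J ∎

  -- Each summand is a product of one weight per copy, so its double sum factors.
  ∑∑-cross : ∑ Hs (λ H → ∑ Hs (cross H)) ≈ T₁ n * T₂ n + T₂ n * T₁ n + T₂ n * T₂ n
  ∑∑-cross = begin
    ∑ Hs (λ H → ∑ Hs (cross H))
      ≈⟨ ∑∑-distrib-+ Hs Hs (λ H J → w₁ H * w₂ J + w₂ H * w₁ J) (λ H J → w₂ H * w₂ J) ⟩
    ∑ Hs (λ H → ∑ Hs (λ J → w₁ H * w₂ J + w₂ H * w₁ J)) + ∑ Hs (λ H → ∑ Hs (λ J → w₂ H * w₂ J))
      ≈⟨ K.+-congʳ (∑∑-distrib-+ Hs Hs (λ H J → w₁ H * w₂ J) (λ H J → w₂ H * w₁ J)) ⟩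
    ∑ Hs (λ H → ∑ Hs (λ J → w₁ H * w₂ J)) + ∑ Hs (λ H → ∑ Hs (λ J → w₂ H * w₁ J))
      + ∑ Hs (λ H → ∑ Hs (λ J → w₂ H * w₂ J))
      ≈⟨ K.+-cong (K.+-cong (product w₁≈ w₂≈) (product w₂≈ w₁≈)) (product w₂≈ w₂≈) ⟩
    T₁ n * T₂ n + T₂ n * T₁ n + T₂ n * T₂ n ∎

  T₂-double : T₂ (suc n) ≈ T₁ n * T₂ n + T₂ n * T₁ n + T₂ n * T₂ n
  T₂-double = begin
    T₂ (suc n)
      ≈⟨ T₂-weight₂ (suc n) ⟩
    ∑ (subsets G⁺.size) (weight₂ (suc n))
      ≈⟨ ∑-subsets-double size (weight₂ (suc n)) ⟩
    _ ≈⟨ ∑∑-cong Hs Hs weight₂-double ⟩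
    ∑ Hs (λ H → ∑ Hs (cross H))
      ≈⟨ ∑∑-cross ⟩
    T₁ n * T₂ n + T₂ n * T₁ n + T₂ n * T₂ n ∎

  T₁-double : z * T₁ (suc n) ≈
    z * y * (T₁ n * T₁ n) + (T₁ n * T₂ n + T₂ n * T₁ n + T₂ n * T₂ n)
  T₁-double = begin
    z * T₁ (suc n)
      ≈⟨ K.*-congˡ {z} (K.trans (T₁-weight₁ (suc n)) (∑-subsets-double size (weight₁ (suc n)))) ⟩
    z * ∑ Hs (λ H → ∑ Hs (λ J →
      weight₁ (suc n) (outside ∷ H Vec.++ J) + weight₁ (suc n) (inside ∷ H Vec.++ J)))
      ≈⟨ *-distribˡ-∑∑ Hs Hs z _ ⟩
    _ ≈⟨ ∑∑-cong Hs Hs weight₁-double ⟩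
    ∑ Hs (λ H → ∑ Hs (λ J → z * y * (w₁ H * w₁ J) + cross H J))
      ≈⟨ ∑∑-distrib-+ Hs Hs _ cross ⟩
    ∑ Hs (λ H → ∑ Hs (λ J → z * y * (w₁ H * w₁ J))) + ∑ Hs (λ H → ∑ Hs (cross H))
      ≈⟨ K.+-congʳ (*-distribˡ-∑∑ Hs Hs (z * y) (λ H J → w₁ H * w₁ J)) ⟨
    z * y * ∑ Hs (λ H → ∑ Hs (λ J → w₁ H * w₁ J)) + ∑ Hs (λ H → ∑ Hs (cross H))
      ≈⟨ K.+-cong (K.*-congˡ {z * y} (product w₁≈ w₁≈)) ∑∑-cross ⟩
    z * y * (T₁ n * T₁ n) + (T₁ n * T₂ n + T₂ n * T₁ n + T₂ n * T₂ n) ∎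

-- The recursions and initial conditions.

T₂≈[x-1]N : ∀ n → T₂ n ≈ (x - 1#) * N n
T₂≈[x-1]N n = proj₂ (T₂-divisible n)

corollary3 : ((n : ℕ) →
    T (suc n) ≈ T₁ (suc n) + (x - 1#) * N (suc n)
    × T₁ (suc n) ≈ y * T₁ n ^ 2 + 2 · (T₁ n * N n) + (x - 1#) * N n ^ 2
    × N (suc n) ≈ 2 · (T₁ n * N n) + (x - 1#) * N n ^ 2)
    × T₁ 0 ≈ 1#
    × N 0 ≈ 1#
corollary3 =
  (λ n →
      K.trans (Tutte-split (suc n)) (K.+-congˡ (T₂≈[x-1]N (suc n)))
    , x-1-cancelˡ _ _ (K.trans (T₁-double n)
        (T₁-recursion-scaled {x - 1#} (T₂≈[x-1]N n) (T₁ n) y))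
    -- `N (suc n)` is only a witness of divisibility, so its recursion passes through `T₂ (suc n)`.
    , x-1-cancelˡ _ _ (K.trans (K.sym (T₂≈[x-1]N (suc n)))
        (K.trans (T₂-double n) (N-recursion-scaled {x - 1#} (T₂≈[x-1]N n) (T₁ n)))))
  -- At index 0 everything evaluates: the edge gives the term 1, and its absence gives x - 1 with
  -- quotient 1.
  , K.refl
  , K.refl
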